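{- Let $k\ge2$ be the cache size, let $1\le r\le k-1$ and $N=k+r$. For the cycle access graph $C_N$ on $N$ vertices, \[\mathcal{I}^{C_N}[\mathrm{FWF},\mathrm{LRU}]=\left[0,\ 1-\frac1k\right].\]
   Context: Paging: a cache holds at most $k$ pages and is initially empty. A request to a page in the cache is a hit; otherwise it is a fault, the page is brought into the cache, evicting a page first if the cache is full. $\mathcal{A}(I)$ is the number of faults of $\mathcal{A}$ on request sequence $I$. LRU evicts the least recently requested cached page; FWF, on a fault with a full cache, empties the cache and then brings in the requested page. Access graph: a graph $G$ whose vertices are the pages; a request sequence respects $G$ if any two consecutive requests are identical or adjacent in $G$; $L(G)$ is the set of such sequences. $C_N$ is the cycle on $N$ vertices. Relative interval: $\mathrm{Min}_{\mathcal{A},\mathcal{B}}(n,G)=\min\{\mathcal{A}(I)-\mathcal{B}(I): I\in L(G),|I|=n\}$, $\mathrm{Max}_{\mathcal{A},\mathcal{B}}(n,G)$ analogously with max; $\mathrm{Min}^G(\mathcal{A},\mathcal{B})=\liminf_{n\to\infty}\mathrm{Min}_{\mathcal{A},\mathcal{B}}(n,G)/n$, $\mathrm{Max}^G(\mathcal{A},\mathcal{B})=\limsup_{n\to\infty}\mathrm{Max}_{\mathcal{A},\mathcal{B}}(n,G)/n$, and $\mathcal{I}^G[\mathcal{A},\mathcal{B}]=[\mathrm{Min}^G(\mathcal{A},\mathcal{B}),\mathrm{Max}^G(\mathcal{A},\mathcal{B})]$. -}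

module Defs where

open import Data.Bool.Base using (if_then_else_)
open import Data.Fin.Base using (Fin; toℕ)
open import Data.Fin.Properties using (_≟_)
import Data.Integer.Base as ℤ
open ℤ using (ℤ)
open import Data.List.Base using (List; []; _∷_; filter; length)
open import Data.List.Extrema.Nat using (argmax)
import Data.List.Membership.DecPropositional as DecMembership
open import Data.List.Relation.Unary.Linked using (Linked)
open import Data.Nat.Base using (ℕ; suc; _≤_; _≥_; s≤s)
open import Data.Nat.Properties using (_<?_)
open import Data.Product.Base using (_×_; _,_; ∃-syntax)
import Data.Rational.Base as ℚ
open ℚ using (ℚ; 0ℚ)
open import Data.Sum.Base using (_⊎_; inj₁; inj₂; swap)
open import Level using (0ℓ)
open import Relation.Binary.Core using (Rel)
open import Relation.Binary.Definitions using (Irreflexive; Symmetric)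
open import Relation.Binary.PropositionalEquality.Core using (_≡_; refl)
open import Relation.Nullary.Negation.Core using (¬_)
open import Relation.Nullary.Decidable.Core using (does; yes; no; ¬?)

record Graph (N : ℕ) : Set₁ where
  field
    _~_      : Rel (Fin N) 0ℓ
    ~-sym    : Symmetric _~_
    ~-irrefl : Irreflexive _≡_ _~_

Requests : ℕ → Set
Requests N = List (Fin N)

infix 4 _∈L_

_∈L_ : ∀ {N} → Requests N → Graph N → Set
I ∈L G = Linked (λ p q → p ≡ q ⊎ p ~ q) I
  where open Graph G

CycleNext : ∀ {N} → Rel (Fin N) 0ℓ
CycleNext {N} i j =
  toℕ j ≡ suc (toℕ i) ⊎ (suc (toℕ i) ≡ N × toℕ j ≡ 0)

cycle : ∀ N → 3 ≤ N → Graph N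
cycle N 3≤N = record
  { _~_      = λ i j → CycleNext i j ⊎ CycleNext j i
  ; ~-sym    = swap
  ; ~-irrefl = λ { refl (inj₁ e) → noLoop 3≤N e ; refl (inj₂ e) → noLoop 3≤N e }
  }
  where
  noLoop : ∀ {m n} → 3 ≤ n → ¬ (m ≡ suc m ⊎ (suc m ≡ n × m ≡ 0))
  noLoop _        (inj₁ ())
  noLoop (s≤s ()) (inj₂ (refl , refl))

-- A policy receives the requests preceding the current one (most recent
-- first) and the contents of a full cache, and returns the pages that stay
-- in the cache when a fault occurs.
Policy : ℕ → Set
Policy N = List (Fin N) → List (Fin N) → List (Fin N)

module _ {N : ℕ} where

  open DecMembership (_≟_ {N}) using (_∈?_)

  faultsFrom : ℕ → Policy N → (history cache : List (Fin N)) → Requests N → ℕ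
  faultsFrom k evict history cache []      = 0
  faultsFrom k evict history cache (p ∷ I) with p ∈? cache
  ... | yes _ = faultsFrom k evict (p ∷ history) cache I
  ... | no  _ = suc (faultsFrom k evict (p ∷ history) (p ∷ room) I)
    where
    room : List (Fin N)
    room = if does (length cache <? k) then cache else evict history cache

  faults : ℕ → Policy N → Requests N → ℕ
  faults k evict = faultsFrom k evict [] []

  -- The number of requests made since the latest request to q.
  age : List (Fin N) → Fin N → ℕ
  age []            q = 0
  age (p ∷ history) q = if does (p ≟ q) then 0 else suc (age history q)

  evictLRU : Policy N
  evictLRU history []       = []
  evictLRU history (q ∷ qs) = filter (λ p → ¬? (p ≟ victim)) (q ∷ qs)
    where
    victim : Fin N
    victim = argmax (age history) q qs

  evictFWF : Policy N
  evictFWF history cache = []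

Algorithm : ℕ → Set
Algorithm N = Requests N → ℕ

LRU FWF : ∀ {N} → ℕ → Algorithm N
LRU k = faults k evictLRU
FWF k = faults k evictFWF

-- The ε-form, since a rational sequence need not have a rational lower or
-- upper limit.
IsLimInf : (ℕ → ℚ) → ℚ → Set
IsLimInf a L = ∀ ε → 0ℚ ℚ.< ε →
  (∃[ M ] ∀ n → n ≥ M → L ℚ.- ε ℚ.< a n) ×
  (∀ M → ∃[ n ] (n ≥ M × a n ℚ.< L ℚ.+ ε))

IsLimSup : (ℕ → ℚ) → ℚ → Set
IsLimSup a L = ∀ ε → 0ℚ ℚ.< ε →
  (∃[ M ] ∀ n → n ≥ M → a n ℚ.< L ℚ.+ ε) ×
  (∀ M → ∃[ n ] (n ≥ M × L ℚ.- ε ℚ.< a n))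

module _ {N : ℕ} (G : Graph N) (𝒜 ℬ : Algorithm N) where

  difference : Requests N → ℤ
  difference I = ℤ.+ 𝒜 I ℤ.- ℤ.+ ℬ I

  IsMin : ℕ → ℤ → Set
  IsMin n m =
    (∃[ I ] (I ∈L G × length I ≡ n × difference I ≡ m)) ×
    (∀ I → I ∈L G → length I ≡ n → m ℤ.≤ difference I)

  IsMax : ℕ → ℤ → Set
  IsMax n m =
    (∃[ I ] (I ∈L G × length I ≡ n × difference I ≡ m)) ×
    (∀ I → I ∈L G → length I ≡ n → difference I ℤ.≤ m)

  -- The index is shifted by one to keep the divisor n of Min(n)/n nonzero;
  -- this does not affect the lower and upper limits.
  perRequest : (ℕ → ℤ) → ℕ → ℚ
  perRequest m n = m (suc n) ℚ./ suc n

  IsRelativeMin : ℚ → Set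
  IsRelativeMin L =
    ∃[ m ] ((∀ n → IsMin n (m n)) × IsLimInf (perRequest m) L)

  IsRelativeMax : ℚ → Set
  IsRelativeMax L =
    ∃[ m ] ((∀ n → IsMax n (m n)) × IsLimSup (perRequest m) L)

  -- The pair (l , u) stands for the interval [l, u].
  IsRelativeInterval : ℚ × ℚ → Set
  IsRelativeInterval (l , u) = IsRelativeMin l × IsRelativeMax u

{-# OPTIONS --safe #-}

-- FWF's cache holds the pages requested since its last flush, which are the most recently
-- requested ones, so it is always contained in LRU's cache; hence LRU ≤ FWF. When FWF
-- flushes, its cache is full and so equals LRU's, and LRU faults too; since FWF faults only
-- k times between flushes, FWF ≤ k LRU, so FWF − LRU ≤ (1 − 1/k) FWF. Constant sequences
-- attain 0. Walking back and forth between the ends of a path with k + 1 vertices attains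
-- 1 − 1/k in the limit: FWF flushes at each end and faults on every request, while LRU
-- keeps the k − 1 inner pages and faults only at the ends.
module Submission where

open import Defs
open import Data.Fin.Base as Fin using (Fin; toℕ)
open import Data.Fin.Properties using (_≟_; injective⇒≤; toℕ-fromℕ<)
open import Data.Integer.Base as ℤ using (ℤ; +_)
import Data.Integer.Properties as ℤ
import Data.Integer.Tactic.RingSolver as ℤSolver
open import Data.List.Base
  using ( List; []; _∷_; _++_; _ʳ++_; length; lookup; filter; replicate; allFin
        ; cartesianProductWith; applyUpTo; applyDownFrom)
import Data.List.Extrema ℤ.≤-totalOrder as ℤExtrema
open import Data.List.Extrema.Nat using (argmax; argmax-sel; f[⊥]≤f[argmax]; f[xs]≤f[argmax])
import Data.List.Membership.DecPropositional as DecMembership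
open import Data.List.Membership.Propositional using (_∈_; _∉_)
open import Data.List.Membership.Propositional.Properties
  using ( ∈-filter⁺; ∈-filter⁻; ∈-lookup; ∈-++⁺ʳ; ∈-cartesianProductWith⁺; ∈-allFin
        ; ∈-applyUpTo⁺; ∈-applyUpTo⁻; ∈-applyDownFrom⁺; ∈-applyDownFrom⁻)
open import Data.List.Properties
  using ( filter-notAll; length-++; length-replicate; ++-identityʳ; length-ʳ++
        ; length-applyUpTo; length-applyDownFrom)
open import Data.List.Relation.Binary.Permutation.Propositional
  using (_↭_; ↭-sym; ↭-trans; ↭-reflexive; prep; ↭⇒↭ₛ)
open import Data.List.Relation.Binary.Permutation.Propositional.Properties
  using (shift; ↭-length; ∈-resp-↭; ++↭ʳ++)
import Data.List.Relation.Binary.Permutation.Setoid.Properties as Permutationₛ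
open import Data.List.Relation.Binary.Subset.Propositional using (_⊆_)
open import Data.List.Relation.Unary.All as All using (All; []; _∷_)
open import Data.List.Relation.Unary.All.Properties using (¬Any⇒All¬; all-filter)
open import Data.List.Relation.Unary.AllPairs using ([]; _∷_)
open import Data.List.Relation.Unary.Any as Any using (here; there; index)
open import Data.List.Relation.Unary.Any.Properties using (lookup-index)
open import Data.List.Relation.Unary.Linked using (Linked; []; [-]; _∷_; linked?)
open import Data.List.Relation.Unary.Unique.Propositional using (Unique)
open import Data.List.Relation.Unary.Unique.Propositional.Properties
  using (Unique[x∷xs]⇒x∉xs; applyUpTo⁺₁; applyDownFrom⁺₁) renaming (filter⁺ to Unique-filter⁺)
open import Data.Nat.Base
  using (ℕ; zero; suc; NonZero; _≤_; _<_; _+_; _*_; _∸_; z≤n; s≤s; z<s; s<s)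
open import Data.Nat.DivMod using (_mod_; m%n<n; m<n⇒m%n≡m)
open import Data.Nat.Properties as ℕ
  using ( +-mono-≤; _<?_; ≤-refl; ≤-reflexive; ≤-trans; <-≤-trans; <⇒≱; ≮⇒≥; n≤1+n
        ; m≤n⇒m≤1+n; +-suc; +-comm; *-suc; *-comm; +-monoˡ-≤; +-monoʳ-≤; *-monoʳ-≤
        ; m≤m+n; m≤n+m; n<1+n; <⇒≤; <⇒≢; module ≤-Reasoning)
open import Data.Nat.Tactic.RingSolver using (solve-∀)
open import Data.Product.Base using (_×_; _,_; proj₁; proj₂; ∃-syntax)
open import Data.Rational.Base as ℚ using (ℚ; mkℚ; 0ℚ; 1ℚ; _/_; _-_; *<*)
import Data.Rational.Properties as ℚ
open import Data.Rational.Unnormalised.Base as ℚᵘ using (mkℚᵘ; *≡*; *≤*)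
import Data.Rational.Unnormalised.Properties as ℚᵘ
open import Data.Sum.Base using (_⊎_; inj₁; inj₂)
open import Function.Base using (_∘_)
open import Relation.Binary.Core using (Rel)
import Relation.Binary.Definitions as B
open import Relation.Binary.PropositionalEquality
  using (_≡_; _≢_; refl; sym; trans; cong; cong₂; subst; subst₂; setoid; module ≡-Reasoning)
import Relation.Binary.Reasoning.Setoid as ≈-Reasoning
open import Relation.Nullary using (¬_; Dec; yes; no; ¬?; contradiction)
open import Relation.Nullary.Decidable using (dec-true; dec-false; _×-dec_; _⊎-dec_)
open import Relation.Unary using (Decidable)

-- Counting in lists without repetitions.

module _ {a} {A : Set a} where

  lookup-injective : ∀ {xs : List A} → Unique xs → ∀ {i j} → lookup xs i ≡ lookup xs j → i ≡ j
  lookup-injective (_ ∷ _) {Fin.zero}  {Fin.zero}  eq = refl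
  lookup-injective (x≢ ∷ _) {Fin.zero} {Fin.suc j} eq = contradiction eq (All.lookup x≢ (∈-lookup j))
  lookup-injective (x≢ ∷ _) {Fin.suc i} {Fin.zero} eq = contradiction (sym eq) (All.lookup x≢ (∈-lookup i))
  lookup-injective (_ ∷ u) {Fin.suc i} {Fin.suc j} eq = cong Fin.suc (lookup-injective u eq)

  -- Pigeonhole: send each position of `xs` to a position of the same element in `ys`. Since `xs`
  -- has no repetitions, this map is injective.
  Unique-⊆⇒length≤ : ∀ {xs ys : List A} → Unique xs → xs ⊆ ys → length xs ≤ length ys
  Unique-⊆⇒length≤ {xs} {ys} u xs⊆ys = injective⇒≤ position-injective
    where
    position : Fin (length xs) → Fin (length ys)
    position i = index (xs⊆ys (∈-lookup i))

    position-injective : ∀ {i j} → position i ≡ position j → i ≡ j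
    position-injective {i} {j} eq = lookup-injective u
      (trans (lookup-index (xs⊆ys (∈-lookup i)))
        (trans (cong (lookup ys) eq) (sym (lookup-index (xs⊆ys (∈-lookup j))))))

  Unique-resp-↭ : ∀ {xs ys : List A} → xs ↭ ys → Unique xs → Unique ys
  Unique-resp-↭ xs↭ys = Permutationₛ.Unique-resp-↭ (setoid A) (↭⇒↭ₛ xs↭ys)

-- Fault counts of a single policy.

module _ {N : ℕ} where

  open DecMembership (_≟_ {N}) using (_∈?_)

  private
    variable
      k : ℕ
      p q : Fin N
      h c c′ I S T : List (Fin N)

  module _ (k : ℕ) (evict : Policy N) where

    -- This and the next two equations restate the branches of `faultsFrom` propositionally, so that
    -- the runs of two policies can be rewritten independently.
    faultsFrom-hit : p ∈ c → faultsFrom k evict h c (p ∷ I) ≡ faultsFrom k evict (p ∷ h) c I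
    faultsFrom-hit {p} {c} p∈c with p ∈? c
    ... | yes _  = refl
    ... | no p∉c = contradiction p∈c p∉c

    faultsFrom-fill : p ∉ c → length c < k →
      faultsFrom k evict h c (p ∷ I) ≡ suc (faultsFrom k evict (p ∷ h) (p ∷ c) I)
    faultsFrom-fill {p} {c} p∉c c<k with p ∈? c
    ... | yes p∈c = contradiction p∈c p∉c
    ... | no _ rewrite dec-true (length c <? k) c<k = refl

    faultsFrom-evict : p ∉ c → ¬ length c < k →
      faultsFrom k evict h c (p ∷ I) ≡ suc (faultsFrom k evict (p ∷ h) (p ∷ evict h c) I)
    faultsFrom-evict {p} {c} p∉c c≮k with p ∈? c
    ... | yes p∈c = contradiction p∈c p∉c
    ... | no _ rewrite dec-false (length c <? k) c≮k = refl

    faultsFrom-hits : ∀ T → T ⊆ c → faultsFrom k evict h c (T ++ I) ≡ faultsFrom k evict (T ʳ++ h) c I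
    faultsFrom-hits []      T⊆c = refl
    faultsFrom-hits (p ∷ T) T⊆c = trans
      (faultsFrom-hit (T⊆c (here refl)))
      (faultsFrom-hits T (T⊆c ∘ there))

    faultsFrom-fills : ∀ T → Unique (T ++ c) → length c + length T ≤ k →
      faultsFrom k evict h c (T ++ I) ≡ length T + faultsFrom k evict (T ʳ++ h) (T ʳ++ c) I
    faultsFrom-fills []          u fits = refl
    faultsFrom-fills {c} (p ∷ T) u fits = trans
      (faultsFrom-fill (Unique[x∷xs]⇒x∉xs u ∘ ∈-++⁺ʳ T)
        (≤-trans (s≤s (m≤m+n _ _)) fits′))
      -- `shift` carries `p` across `T` to the front of the cache, where the request has put it.
      (cong suc (faultsFrom-fills T (Unique-resp-↭ (↭-sym (shift p T c)) u) fits′))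
      where
      fits′ : suc (length c + length T) ≤ k
      fits′ = subst (_≤ k) (+-suc (length c) (length T)) fits

    faultsFrom≤length : ∀ h c I → faultsFrom k evict h c I ≤ length I
    faultsFrom≤length h c []      = z≤n
    faultsFrom≤length h c (p ∷ I) with p ∈? c
    ... | yes _ = m≤n⇒m≤1+n (faultsFrom≤length (p ∷ h) c I)
    ... | no _  = s≤s (faultsFrom≤length (p ∷ h) _ I)

    faultsFrom-repeat : ∀ n → p ∈ c → faultsFrom k evict h c (replicate n p) ≡ 0
    faultsFrom-repeat zero    p∈c = refl
    faultsFrom-repeat (suc n) p∈c = trans (faultsFrom-hit p∈c) (faultsFrom-repeat n p∈c)

    faults-constant : ∀ n p → faults k evict (replicate (suc n) p) ≡ 1
    faults-constant n p = cong suc (faultsFrom-repeat n (here refl))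

  -- Ages and recently requested pages.

  -- S consists of the most recently requested pages; a page never requested has age length h.
  Recent : List (Fin N) → List (Fin N) → Set
  Recent h S = ∀ {p q} → p ∈ S → q ∉ S → age h p < age h q

  age-head : q ≢ p → age (p ∷ h) p < age (p ∷ h) q
  age-head {q} {p} q≢p with p ≟ p | p ≟ q
  ... | no p≢p | _       = contradiction refl p≢p
  ... | yes _  | yes p≡q = contradiction (sym p≡q) q≢p
  ... | yes _  | no _    = z<s

  -- The request to `t` raises the age of `q` by one, and either does the same to `p` or resets its
  -- age to 0.
  age-mono-∷ : ∀ t → q ≢ t → age h p < age h q → age (t ∷ h) p < age (t ∷ h) q
  age-mono-∷ {q} {p = p} t q≢t p<q with t ≟ p | t ≟ q
  ... | _     | yes t≡q = contradiction (sym t≡q) q≢t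
  ... | yes _ | no _    = z<s
  ... | no _  | no _    = s≤s p<q

  age-mono-ʳ++ : ∀ T → q ∉ T → age h p < age h q → age (T ʳ++ h) p < age (T ʳ++ h) q
  age-mono-ʳ++ []      q∉T p<q = p<q
  age-mono-ʳ++ {h = h} (t ∷ T) q∉T p<q =
    age-mono-ʳ++ {h = t ∷ h} T (q∉T ∘ there) (age-mono-∷ {h = h} t (q∉T ∘ here) p<q)

  Recent-hit : p ∈ S → Recent h S → Recent (p ∷ h) S
  Recent-hit {p = p} {h = h} p∈S recent p′∈S q∉S =
    age-mono-∷ {h = h} p (λ { refl → q∉S p∈S }) (recent p′∈S q∉S)

  Recent-∷ : Recent h S → Recent (p ∷ h) (p ∷ S)
  Recent-∷ {h} {p = p} recent (here refl)  q∉ = age-head {h = h} (q∉ ∘ here)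
  Recent-∷ {h} {p = p} recent (there p′∈S) q∉ =
    age-mono-∷ {h = h} p (q∉ ∘ here) (recent p′∈S (q∉ ∘ there))

  Recent-[] : Recent h []
  Recent-[] ()

  -- A page of `T` becomes younger than `q` when it is requested, and stays younger because `T`
  -- never requests `q`. The reversal reflects that histories list the latest request first.
  Recent-ʳ++ : ∀ T → Recent (T ʳ++ h) T
  Recent-ʳ++ {h} (t ∷ T) (here refl) q∉ =
    age-mono-ʳ++ {h = t ∷ h} T (q∉ ∘ there) (age-head {h = h} (q∉ ∘ here))
  Recent-ʳ++ (t ∷ T) (there p∈T) q∉ = Recent-ʳ++ T p∈T (q∉ ∘ there)

  -- Evictions by LRU.

  argmax-∈ : ∀ (f : Fin N → ℕ) q qs → argmax f q qs ∈ q ∷ qs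
  argmax-∈ f q qs with argmax-sel f q qs
  ... | inj₁ eq = here eq
  ... | inj₂ ∈qs = there ∈qs

  ≤argmax : ∀ (f : Fin N → ℕ) q qs → p ∈ q ∷ qs → f p ≤ f (argmax f q qs)
  ≤argmax f q qs (here refl)  = f[⊥]≤f[argmax] {f = f} q qs
  ≤argmax f q qs (there p∈qs) = All.lookup (f[xs]≤f[argmax] {f = f} q qs) p∈qs

  spared? : ∀ h q qs → Decidable (λ (p : Fin N) → p ≢ argmax (age h) q qs)
  spared? h q qs p = ¬? (p ≟ argmax (age h) q qs)

  evictLRU-⊆ : ∀ h c → evictLRU h c ⊆ c
  evictLRU-⊆ h []       ()
  evictLRU-⊆ h (q ∷ qs) p∈ = proj₁ (∈-filter⁻ (spared? h q qs) {xs = q ∷ qs} p∈)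

  evictLRU-Unique : ∀ h → Unique c → Unique (evictLRU h c)
  evictLRU-Unique {[]}     h u = u
  evictLRU-Unique {q ∷ qs} h u = Unique-filter⁺ (spared? h q qs) u

  -- The victim is itself a cached page, so the filter drops at least one entry.
  evictLRU-length : ∀ h c → 0 < length c → length (evictLRU h c) < length c
  evictLRU-length h (q ∷ qs) _ = filter-notAll (spared? h q qs) (q ∷ qs)
    (Any.map (λ eq neq → neq (sym eq)) (argmax-∈ (age h) q qs))

  -- By counting, c contains a page outside S, and it is older than all of S.
  evictLRU-keeps : Recent h S → S ⊆ c → Unique c → length S < length c → S ⊆ evictLRU h c
  evictLRU-keeps {S = S} {c = []} recent S⊆c u S<c {p} p∈S = S⊆c p∈S
  evictLRU-keeps {h} {S} {c = q ∷ qs} recent S⊆c u S<c {p} p∈S =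
    ∈-filter⁺ (spared? h q qs) (S⊆c p∈S) p≢victim
    where
    p≢victim : p ≢ argmax (age h) q qs
    p≢victim refl = <⇒≱ S<c (Unique-⊆⇒length≤ u c⊆S)
      where
      c⊆S : q ∷ qs ⊆ S
      c⊆S {x} x∈c with x ∈? S
      ... | yes x∈S = x∈S
      ... | no x∉S  = contradiction (≤argmax (age h) q qs x∈c) (<⇒≱ (recent p∈S x∉S))

  ∷-Unique : p ∉ c → Unique c → Unique (p ∷ c)
  ∷-Unique p∉c u = ¬Any⇒All¬ _ p∉c ∷ u

  ∷-⊆ : p ∈ c → S ⊆ c → p ∷ S ⊆ c
  ∷-⊆ p∈c S⊆c (here refl)  = p∈c
  ∷-⊆ p∈c S⊆c (there q∈S) = S⊆c q∈S

  -- Hides whether LRU used a free slot or evicted a page: all that matters afterwards is that the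
  -- new cache retains `p` and `S`.
  record LRUStep (k : ℕ) (h c S : List (Fin N)) (p : Fin N) : Set where
    field
      cache   : List (Fin N)
      covers  : p ∷ S ⊆ cache
      unique  : Unique cache
      fits    : length cache ≤ k
      faults≡ : ∀ I → faultsFrom k evictLRU h c (p ∷ I) ≡ suc (faultsFrom k evictLRU (p ∷ h) cache I)

  -- With a free slot nothing is lost. A full cache is longer than `S`, so by `evictLRU-keeps` the
  -- victim lies outside `S`.
  LRU-fault : 0 < k → Recent h S → S ⊆ c → Unique c → length c ≤ k → length S < k →
    p ∉ c → LRUStep k h c S p
  LRU-fault {k = k} {h} {S} {c} {p} 0<k recent S⊆c u c≤k S<k p∉c with length c <? k
  ... | yes c<k = record
    { cache = p ∷ c
    ; covers = ∷-⊆ (here refl) (there ∘ S⊆c)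
    ; unique = ∷-Unique p∉c u
    ; fits = c<k
    ; faults≡ = λ I → faultsFrom-fill k evictLRU p∉c c<k
    }
  ... | no c≮k = record
    { cache = p ∷ evictLRU h c
    ; covers = ∷-⊆ (here refl) (there ∘ evictLRU-keeps {h = h} recent S⊆c u (<-≤-trans S<k k≤c))
    ; unique = ∷-Unique (p∉c ∘ evictLRU-⊆ h c) (evictLRU-Unique h u)
    ; fits = <-≤-trans (evictLRU-length h c (<-≤-trans 0<k k≤c)) c≤k
    ; faults≡ = λ I → faultsFrom-evict k evictLRU p∉c c≮k
    }
    where
    k≤c : k ≤ length c
    k≤c = ≮⇒≥ c≮k

  -- FWF and LRU run side by side.

  record Coupled (k : ℕ) (h cF cL : List (Fin N)) : Set where
    field
      recent  : Recent h cF
      cF⊆cL   : cF ⊆ cL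
      uniqueF : Unique cF
      uniqueL : Unique cL
      cF≤k    : length cF ≤ k
      cL≤k    : length cL ≤ k

  module _ {k : ℕ} (0<k : 0 < k) where

    -- The second bound is amortised: |cF| counts the faults FWF has already made in its phase.
    Coupled-bounds : ∀ {h cF cL} → Coupled k h cF cL → ∀ I →
      faultsFrom k evictLRU h cL I ≤ faultsFrom k evictFWF h cF I ×
      faultsFrom k evictFWF h cF I + length cF ≤ k * faultsFrom k evictLRU h cL I + k
    Coupled-bounds coupled [] = z≤n , ≤-trans cF≤k (m≤n+m k (k * 0))
      where open Coupled coupled
    Coupled-bounds {h} {cF} {cL} coupled (p ∷ I) = by-cases (p ∈? cF) (length cF <? k) (p ∈? cL)
      where
      open Coupled coupled

      Bounds : Set
      Bounds =
        faultsFrom k evictLRU h cL (p ∷ I) ≤ faultsFrom k evictFWF h cF (p ∷ I) ×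
        faultsFrom k evictFWF h cF (p ∷ I) + length cF ≤ k * faultsFrom k evictLRU h cL (p ∷ I) + k

      fill-fault : p ∉ cF → length cF < k → LRUStep k h cL cF p → Bounds
      fill-fault p∉cF cF<k record { covers = covers ; unique = unique ; fits = fits ; faults≡ = faults≡ }
        rewrite faultsFrom-fill k evictFWF {h = h} {I} p∉cF cF<k | faults≡ I
        with L≤F , F≤kL ← Coupled-bounds {p ∷ h} {p ∷ cF} (record
          { recent = Recent-∷ {h} recent ; cF⊆cL = covers
          ; uniqueF = ∷-Unique p∉cF uniqueF ; uniqueL = unique ; cF≤k = cF<k ; cL≤k = fits }) I
        -- The fault of FWF lengthens `cF` by one, so the left-hand sum agrees with that of the
        -- induction hypothesis; the fault of LRU only raises the right-hand side.
        = s≤s L≤F , ≤-trans (≤-reflexive (sym (+-suc _ _)))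
                      (≤-trans F≤kL (+-monoˡ-≤ k (*-monoʳ-≤ k (n≤1+n _))))

      flush-fault : p ∉ cF → ¬ length cF < k → LRUStep k h cL [] p → Bounds
      flush-fault p∉cF cF≮k
        record { cache = cache ; covers = covers ; unique = unique ; fits = fits ; faults≡ = faults≡ }
        rewrite faultsFrom-evict k evictFWF {h = h} {I} p∉cF cF≮k | faults≡ I
        with L≤F , F≤kL ← Coupled-bounds {p ∷ h} {p ∷ []} (record
          { recent = Recent-∷ {h} (Recent-[] {h}) ; cF⊆cL = covers
          ; uniqueF = [] ∷ [] ; uniqueL = unique ; cF≤k = 0<k ; cL≤k = fits }) I
        -- The new phase starts with one cached page, so the induction hypothesis bounds `F′ + 1`.
        -- The pages lost in the flush, at most `k`, are paid for by the fault of LRU.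
        = s≤s L≤F , (begin
          suc F′ + length cF   ≤⟨ +-monoʳ-≤ (suc F′) cF≤k ⟩
          suc F′ + k           ≡⟨ cong (λ x → x + k) (+-comm 1 F′) ⟩
          (F′ + 1) + k         ≤⟨ +-monoˡ-≤ k F≤kL ⟩
          (k * L′ + k) + k     ≡⟨ cong (λ x → x + k) (trans (+-comm (k * L′) k) (sym (*-suc k L′))) ⟩
          k * suc L′ + k       ∎)
        where
        open ≤-Reasoning
        F′ L′ : ℕ
        F′ = faultsFrom k evictFWF (p ∷ h) (p ∷ []) I
        L′ = faultsFrom k evictLRU (p ∷ h) cache I

      by-cases : Dec (p ∈ cF) → Dec (length cF < k) → Dec (p ∈ cL) → Bounds
      by-cases (yes p∈cF) _ _
        rewrite faultsFrom-hit k evictFWF {h = h} {I} p∈cF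
              | faultsFrom-hit k evictLRU {h = h} {I} (cF⊆cL p∈cF)
        = Coupled-bounds (record
          { recent = Recent-hit {h = h} p∈cF recent ; cF⊆cL = cF⊆cL
          ; uniqueF = uniqueF ; uniqueL = uniqueL ; cF≤k = cF≤k ; cL≤k = cL≤k }) I
      by-cases (no p∉cF) (yes cF<k) (yes p∈cL)
        rewrite faultsFrom-fill k evictFWF {h = h} {I} p∉cF cF<k
              | faultsFrom-hit k evictLRU {h = h} {I} p∈cL
        with L≤F , F≤kL ← Coupled-bounds {p ∷ h} {p ∷ cF} {cL} (record
          { recent = Recent-∷ {h} recent ; cF⊆cL = ∷-⊆ p∈cL cF⊆cL
          ; uniqueF = ∷-Unique p∉cF uniqueF ; uniqueL = uniqueL ; cF≤k = cF<k ; cL≤k = cL≤k }) I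
        = m≤n⇒m≤1+n L≤F , ≤-trans (≤-reflexive (sym (+-suc _ _))) F≤kL
      by-cases (no p∉cF) (yes cF<k) (no p∉cL) =
        fill-fault p∉cF cF<k (LRU-fault 0<k recent cF⊆cL uniqueL cL≤k cF<k p∉cL)
      -- A flush finds cF full, so cL has the same pages and LRU faults as well.
      by-cases (no p∉cF) (no cF≮k) (yes p∈cL) =
        contradiction (≤-trans (Unique-⊆⇒length≤ (∷-Unique p∉cF uniqueF) (∷-⊆ p∈cL cF⊆cL)) cL≤k) cF≮k
      by-cases (no p∉cF) (no cF≮k) (no p∉cL) =
        flush-fault p∉cF cF≮k (LRU-fault 0<k (Recent-[] {h}) (λ ()) uniqueL cL≤k 0<k p∉cL)

    -- Applied to empty caches, `Coupled-bounds` would leave an excess of `k`. It is applied after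
    -- the first request instead, where the initial fault of LRU absorbs this excess.
    LRU-FWF-bounds : ∀ (I : Requests N) → LRU k I ≤ FWF k I × FWF k I ≤ k * LRU k I
    LRU-FWF-bounds []      = z≤n , z≤n
    LRU-FWF-bounds (p ∷ I)
      rewrite faultsFrom-fill k evictLRU {p} {[]} {[]} {I} (λ ()) 0<k
            | faultsFrom-fill k evictFWF {p} {[]} {[]} {I} (λ ()) 0<k
      with L≤F , F≤kL ← Coupled-bounds {p ∷ []} {p ∷ []} {p ∷ []} (record
        { recent = Recent-∷ {[]} (Recent-[] {[]}) ; cF⊆cL = λ x → x
        ; uniqueF = [] ∷ [] ; uniqueL = [] ∷ [] ; cF≤k = 0<k ; cL≤k = 0<k }) I
      = s≤s L≤F , (begin
        suc F′       ≡⟨ +-comm 1 F′ ⟩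
        F′ + 1       ≤⟨ F≤kL ⟩
        k * L′ + k   ≡⟨ trans (+-comm (k * L′) k) (sym (*-suc k L′)) ⟩
        k * suc L′   ∎)
      where
      open ≤-Reasoning
      F′ L′ : ℕ
      F′ = faultsFrom k evictFWF (p ∷ []) (p ∷ []) I
      L′ = faultsFrom k evictLRU (p ∷ []) (p ∷ []) I

  Recent-resp : S ⊆ T → T ⊆ S → Recent h S → Recent h T
  Recent-resp S⊆T T⊆S recent p∈T q∉T = recent (T⊆S p∈T) (q∉T ∘ S⊆T)

-- Fault counts on zigzag sequences.

module _ {a} {A : Set a} where

  -- p S q T p S q …, stopping at the m-th turning point after the initial p.
  excursions zigzag : ℕ → A → List A → A → List A → List A
  excursions zero    p S q T = []
  excursions (suc m) p S q T = S ++ zigzag m q T p S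

  zigzag m p S q T = p ∷ excursions m p S q T

module _ {N : ℕ} {k : ℕ} where

  open DecMembership (_≟_ {N}) using (_∈?_)

  private
    variable
      p q : Fin N
      h c S T : List (Fin N)

  length-zigzag : ∀ m → suc (length S) ≡ k → suc (length T) ≡ k →
    length (zigzag m p S q T) ≡ suc (m * k)
  length-zigzag zero refl eq = refl
  length-zigzag {S} {T} {p} {q} (suc m) refl eq = cong suc (trans (length-++ S)
    (trans (cong (λ n → length S + n) (length-zigzag {T} {S} {q} {p} m eq refl)) (+-suc _ _)))

  -- An empty cache and a full one behave alike here: after the fault `p` is alone in the cache. So
  -- the start of the sequence and every later turning point can be treated together.
  FWF-restart : ∀ I → c ≡ [] ⊎ k ≤ length c → p ∉ c →
    faultsFrom k evictFWF h c (p ∷ I) ≡ suc (faultsFrom k evictFWF (p ∷ h) (p ∷ []) I)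
  FWF-restart {c} I state p∉c with length c <? k
  FWF-restart I (inj₁ refl) p∉c | yes c<k = faultsFrom-fill k evictFWF {I = I} p∉c c<k
  FWF-restart I (inj₂ k≤c)  p∉c | yes c<k = contradiction k≤c (<⇒≱ c<k)
  FWF-restart I _           p∉c | no c≮k  = faultsFrom-evict k evictFWF {I = I} p∉c c≮k

  -- The `k` distinct pages `p ∷ S` exactly fill the cache, so the turning point `q` causes a flush,
  -- and the induction continues with the two ends exchanged.
  FWF-zigzag : ∀ m → c ≡ [] ⊎ k ≤ length c → p ∉ c →
    suc (length S) ≡ k → suc (length T) ≡ k →
    Unique (p ∷ S) → Unique (q ∷ T) → p ∉ q ∷ T → q ∉ p ∷ S →
    faultsFrom k evictFWF h c (zigzag m p S q T) ≡ suc (m * k)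
  FWF-zigzag zero state p∉c |S| |T| uS uT p∉ q∉ = FWF-restart [] state p∉c
  FWF-zigzag {c} {p} {S} {T} {q} {h} (suc m) state p∉c |S| |T| uS uT p∉ q∉ = begin
    F h c (p ∷ S ++ Z)
      ≡⟨ FWF-restart _ state p∉c ⟩
    suc (F (p ∷ h) (p ∷ []) (S ++ Z))
      ≡⟨ cong suc (faultsFrom-fills k evictFWF S (Unique-resp-↭ p∷S↭S++p uS) (≤-reflexive |S|)) ⟩
    suc (length S) + F (S ʳ++ (p ∷ h)) (S ʳ++ (p ∷ [])) Z
      ≡⟨ cong₂ _+_ |S| (FWF-zigzag {S = T} {T = S} {h = S ʳ++ (p ∷ h)} m
           (inj₂ k≤) q∉′ |T| |S| uT uS q∉ p∉) ⟩
    k + suc (m * k)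
      ≡⟨ +-suc k (m * k) ⟩
    suc (k + m * k) ∎
    where
    open ≡-Reasoning
    F = faultsFrom k evictFWF
    Z = zigzag m q T p S

    p∷S↭S++p : p ∷ S ↭ S ++ p ∷ []
    p∷S↭S++p = ↭-trans (prep p (↭-reflexive (sym (++-identityʳ S)))) (↭-sym (shift p S []))

    k≤ : k ≤ length (S ʳ++ (p ∷ []))
    k≤ = ≤-reflexive (sym (trans (length-ʳ++ S) (trans (+-comm (length S) 1) |S|)))

    q∉′ : q ∉ S ʳ++ (p ∷ [])
    q∉′ q∈ = q∉ (∈-resp-↭ (↭-trans (↭-sym (++↭ʳ++ S (p ∷ []))) (↭-sym p∷S↭S++p)) q∈)

  -- S and T list the same pages: they stay cached while only the turning points p and q fault.
  LRU-zigzag : 0 < k → ∀ m → Recent h S → S ⊆ c → Unique c → length c ≤ k →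
    S ⊆ T → T ⊆ S → length S < k → length T < k →
    faultsFrom k evictLRU h c (zigzag m p S q T) ≤ suc m
  LRU-zigzag {h} {c = c} 0<k zero _ _ _ _ _ _ _ _ = faultsFrom≤length k evictLRU h c _
  LRU-zigzag {h} {S} {c} {T} {p} {q} 0<k (suc m) recent S⊆c u c≤k S⊆T T⊆S S<k T<k =
    by-cases (p ∈? c)
    where
    open ≤-Reasoning
    L = faultsFrom k evictLRU
    Z = zigzag m q T p S

    rest : ∀ {c} → S ⊆ c → Unique c → length c ≤ k → L (p ∷ h) c (S ++ Z) ≤ suc m
    rest {c} S⊆c u c≤k = begin
      L (p ∷ h) c (S ++ Z)   ≡⟨ faultsFrom-hits k evictLRU S S⊆c ⟩
      -- The inner pages, having just been requested, are again the most recent ones; `T` takes over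
      -- the role of `S`.
      L (S ʳ++ (p ∷ h)) c Z  ≤⟨ LRU-zigzag 0<k m
                                  (Recent-resp {h = S ʳ++ (p ∷ h)} S⊆T T⊆S (Recent-ʳ++ {h = p ∷ h} S))
                                  (S⊆c ∘ T⊆S) u c≤k T⊆S S⊆T T<k S<k ⟩
      suc m                  ∎

    by-cases : Dec (p ∈ c) → L h c (p ∷ S ++ Z) ≤ suc (suc m)
    by-cases (yes p∈c) = begin
      L h c (p ∷ S ++ Z)     ≡⟨ faultsFrom-hit k evictLRU p∈c ⟩
      L (p ∷ h) c (S ++ Z)   ≤⟨ rest S⊆c u c≤k ⟩
      suc m                  ≤⟨ n≤1+n _ ⟩
      suc (suc m)            ∎
    by-cases (no p∉c) = begin
      L h c (p ∷ S ++ Z)               ≡⟨ faults≡ (S ++ Z) ⟩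
      suc (L (p ∷ h) cache (S ++ Z))   ≤⟨ s≤s (rest (covers ∘ there) unique fits) ⟩
      suc (suc m)                      ∎
      where open LRUStep (LRU-fault {h = h} 0<k recent S⊆c u c≤k S<k p∉c)

  -- The first leg fills the empty cache with `k` faults. The inner pages are then cached, and
  -- `LRU-zigzag` charges one fault to each of the `suc m` remaining turning points.
  LRU-zigzag-from-empty : ∀ m → suc (length S) ≡ k → suc (length T) ≡ k → Unique (p ∷ S) →
    S ⊆ T → T ⊆ S → LRU k (zigzag (suc m) p S q T) ≤ k + suc m
  LRU-zigzag-from-empty {S} {T} {p} {q} m |S| |T| u S⊆T T⊆S = begin
    LRU k (p ∷ S ++ Z)
      ≡⟨ faultsFrom-fills k evictLRU (p ∷ S)
           (Unique-resp-↭ (↭-reflexive (sym (++-identityʳ _))) u) (≤-reflexive |S|) ⟩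
    suc (length S) + faultsFrom k evictLRU h₁ h₁ Z
      ≤⟨ +-mono-≤ (≤-reflexive |S|) (LRU-zigzag 0<k m
           (Recent-resp {h = h₁} S⊆T T⊆S (Recent-ʳ++ {h = p ∷ []} S))
           (λ x∈T → ∈-resp-↭ ↭h₁ (there (T⊆S x∈T)))
           (Unique-resp-↭ ↭h₁ u)
           (≤-reflexive (trans (sym (↭-length ↭h₁)) |S|))
           T⊆S S⊆T (≤-reflexive |T|) (≤-reflexive |S|)) ⟩
    k + suc m ∎
    where
    open ≤-Reasoning
    Z = zigzag m q T p S
    h₁ = S ʳ++ (p ∷ [])

    ↭h₁ : p ∷ S ↭ h₁
    ↭h₁ = ↭-trans (↭-reflexive (sym (++-identityʳ _))) (++↭ʳ++ (p ∷ S) [])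

    0<k : 0 < k
    0<k = subst (0 <_) |S| z<s

-- Existence of the maximum for each length.

cycleNext? : ∀ {N} → B.Decidable (CycleNext {N})
cycleNext? {N} i j =
  (toℕ j ℕ.≟ suc (toℕ i)) ⊎-dec (suc (toℕ i) ℕ.≟ N ×-dec toℕ j ℕ.≟ 0)

module _ {N : ℕ} where

  requestsOfLength : ℕ → List (Requests N)
  requestsOfLength zero    = [] ∷ []
  requestsOfLength (suc n) = cartesianProductWith _∷_ (allFin N) (requestsOfLength n)

  ∈-requestsOfLength : ∀ I → I ∈ requestsOfLength (length I)
  ∈-requestsOfLength []      = here refl
  ∈-requestsOfLength (p ∷ I) = ∈-cartesianProductWith⁺ _∷_ (∈-allFin p) (∈-requestsOfLength I)

  constant-∈L : ∀ (G : Graph N) p n → replicate n p ∈L G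
  constant-∈L G p zero          = []
  constant-∈L G p (suc zero)    = [-]
  constant-∈L G p (suc (suc n)) = inj₁ refl ∷ constant-∈L G p (suc n)

  -- The sequences of a given length can be enumerated and filtered by the decidable graph
  -- condition. The constant sequence respects every graph and serves as the default value of
  -- `argmax`.
  max-exists : (G : Graph N) → B.Decidable (Graph._~_ G) → Fin N → ∀ 𝒜 ℬ n → ∃[ m ] IsMax G 𝒜 ℬ n m
  max-exists G _~?_ p 𝒜 ℬ n =
    d (ℤExtrema.argmax d I₀ valid) ,
    (_ , proj₁ best , proj₂ best , refl) ,
    λ { I I∈L refl → All.lookup (ℤExtrema.f[xs]≤f[argmax] {f = d} I₀ valid)
          (∈-filter⁺ valid? (∈-requestsOfLength I) (I∈L , refl)) }
    where
    d = difference G 𝒜 ℬ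
    I₀ = replicate n p

    valid? : ∀ I → Dec (I ∈L G × length I ≡ n)
    valid? I = linked? (λ p q → (p ≟ q) ⊎-dec (p ~? q)) I ×-dec (length I ℕ.≟ n)

    valid : List (Requests N)
    valid = filter valid? (requestsOfLength n)

    best : ℤExtrema.argmax d I₀ valid ∈L G × length (ℤExtrema.argmax d I₀ valid) ≡ n
    best = ℤExtrema.argmax-all d (constant-∈L G p n , length-replicate n)
      (all-filter valid? (requestsOfLength n))

-- Joining walks at a common vertex.

module _ {a ℓ} {A : Set a} {R : Rel A ℓ} where

  Linked-applyUpTo-++ : ∀ (f : ℕ → A) n {xs} → (∀ {i} → i < n → R (f i) (f (suc i))) →
    Linked R (f n ∷ xs) → Linked R (applyUpTo f n ++ f n ∷ xs)
  Linked-applyUpTo-++ f zero          step xs↝ = xs↝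
  Linked-applyUpTo-++ f (suc zero)    step xs↝ = step z<s ∷ xs↝
  Linked-applyUpTo-++ f (suc (suc n)) step xs↝ =
    step z<s ∷ Linked-applyUpTo-++ (f ∘ suc) (suc n) (step ∘ s<s) xs↝

  Linked-applyDownFrom-++ : ∀ (f : ℕ → A) n {xs} → (∀ {i} → i < n → R (f (suc i)) (f i)) →
    Linked R (f 0 ∷ xs) → Linked R (applyDownFrom (f ∘ suc) n ++ f 0 ∷ xs)
  Linked-applyDownFrom-++ f zero          step xs↝ = xs↝
  Linked-applyDownFrom-++ f (suc zero)    step xs↝ = step z<s ∷ xs↝
  Linked-applyDownFrom-++ f (suc (suc n)) step xs↝ =
    step ≤-refl ∷ Linked-applyDownFrom-++ f (suc n) (step ∘ m≤n⇒m≤1+n) xs↝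

-- Arithmetic of fractions.

/-mono-≤ : ∀ i m j n → i ℤ.* + suc n ℤ.≤ j ℤ.* + suc m → i / suc m ℚ.≤ j / suc n
/-mono-≤ i m j n le = ℚ.toℚᵘ-cancel-≤
  (ℚᵘ.≤-respˡ-≃ (ℚᵘ.≃-sym (ℚ.toℚᵘ-fromℚᵘ (mkℚᵘ i m)))
    (ℚᵘ.≤-respʳ-≃ (ℚᵘ.≃-sym (ℚ.toℚᵘ-fromℚᵘ (mkℚᵘ j n))) (*≤* le)))

/-mono-≤-pos : ∀ a m b n → a * suc n ≤ b * suc m → + a / suc m ℚ.≤ + b / suc n
/-mono-≤-pos a m b n le = /-mono-≤ (+ a) m (+ b) n
  (subst₂ ℤ._≤_ (ℤ.pos-* a (suc n)) (ℤ.pos-* b (suc m)) (ℤ.+≤+ le))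

/-distribʳ-+ : ∀ i j n → (i ℤ.+ j) / suc n ≡ i / suc n ℚ.+ j / suc n
/-distribʳ-+ i j n = ℚ.toℚᵘ-injective (begin
  ℚ.toℚᵘ ((i ℤ.+ j) / suc n)                    ≈⟨ ℚ.toℚᵘ-fromℚᵘ (mkℚᵘ (i ℤ.+ j) n) ⟩
  mkℚᵘ (i ℤ.+ j) n                              ≈⟨ *≡* (cross i j (+ suc n)) ⟩
  mkℚᵘ i n ℚᵘ.+ mkℚᵘ j n                        ≈⟨ ℚᵘ.+-cong (ℚ.toℚᵘ-fromℚᵘ (mkℚᵘ i n)) (ℚ.toℚᵘ-fromℚᵘ (mkℚᵘ j n)) ⟨
  ℚ.toℚᵘ (i / suc n) ℚᵘ.+ ℚ.toℚᵘ (j / suc n)    ≈⟨ ℚ.toℚᵘ-homo-+ (i / suc n) (j / suc n) ⟨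
  ℚ.toℚᵘ (i / suc n ℚ.+ j / suc n)              ∎)
  where
  open ≈-Reasoning ℚᵘ.≃-setoid
  cross : ∀ i j n → (i ℤ.+ j) ℤ.* (n ℤ.* n) ≡ (i ℤ.* n ℤ.+ j ℤ.* n) ℤ.* n
  cross = ℤSolver.solve-∀

n/n≡1 : ∀ n → + suc n / suc n ≡ 1ℚ
n/n≡1 n = ℚ.fromℚᵘ-cong {mkℚᵘ (+ suc n) n} {mkℚᵘ (+ 1) 0} (*≡* (ℤ.*-comm (+ suc n) (+ 1)))

1-1/n : ∀ n → 1ℚ - + 1 / suc n ≡ + n / suc n
1-1/n n = begin
  1ℚ - x                     ≡⟨ cong (_- x) (n/n≡1 n) ⟨
  + suc n / suc n - x        ≡⟨ cong (λ m → + m / suc n - x) (+-comm 1 n) ⟩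
  + (n + 1) / suc n - x      ≡⟨ cong (_- x) (/-distribʳ-+ (+ n) (+ 1) n) ⟩
  (+ n / suc n ℚ.+ x) - x    ≡⟨ ℚ.+-assoc (+ n / suc n) x (ℚ.- x) ⟩
  + n / suc n ℚ.+ (x - x)    ≡⟨ cong (+ n / suc n ℚ.+_) (ℚ.+-inverseʳ x) ⟩
  + n / suc n ℚ.+ 0ℚ           ≡⟨ ℚ.+-identityʳ _ ⟩
  + n / suc n                  ∎
  where
  open ≡-Reasoning
  x = + 1 / suc n

-- For `ε` equal to `suc a` over `suc b`, cross multiplication leaves `k * suc b < suc a * suc n`,
-- so the denominator of `ε` serves as `B`.
archimedean : ∀ k ε → 0ℚ ℚ.< ε → ∃[ B ] (∀ n → B * k ≤ n → + k / suc n ℚ.< ε)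
archimedean k (mkℚ (+ zero)   b _) (*<* (ℤ.+<+ ()))
archimedean k (mkℚ ℤ.-[1+ _ ] b _) (*<* ())
archimedean k ε@(mkℚ (+ suc a) b _) _ = suc b , λ n Bk≤n → ℚ.toℚᵘ-cancel-<
  (ℚᵘ.<-respˡ-≃ (ℚᵘ.≃-sym (ℚ.toℚᵘ-fromℚᵘ (mkℚᵘ (+ k) n)))
    (ℚᵘ.*<* (subst₂ ℤ._<_ (ℤ.pos-* k (suc b)) (ℤ.pos-* (suc a) (suc n)) (ℤ.+<+ (begin-strict
      k * suc b       ≡⟨ *-comm k (suc b) ⟩
      suc b * k       ≤⟨ Bk≤n ⟩
      n               <⟨ n<1+n n ⟩
      suc n           ≤⟨ m≤m+n (suc n) (a * suc n) ⟩
      suc a * suc n   ∎)))))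
  where open ≤-Reasoning

p<q+r⇒p-r<q : ∀ {p q r} → p ℚ.< q ℚ.+ r → p - r ℚ.< q
p<q+r⇒p-r<q {p} {q} {r} lt = subst (p - r ℚ.<_)
  (trans (ℚ.+-assoc q r (ℚ.- r)) (trans (cong (q ℚ.+_) (ℚ.+-inverseʳ r)) (ℚ.+-identityʳ q)))
  (ℚ.+-monoˡ-< (ℚ.- r) lt)

p<p+q : ∀ {p q} → 0ℚ ℚ.< q → p ℚ.< p ℚ.+ q
p<p+q {p} {q} 0<q = subst (ℚ._< p ℚ.+ q) (ℚ.+-identityʳ p) (ℚ.+-monoʳ-< p 0<q)

-- Sweeps along a path with one page more than the cache holds.

module _ {N : ℕ} (n : ℕ) (f : ℕ → Fin N)
         (f-injective : ∀ {i j} → i ≤ suc n → j ≤ suc n → f i ≡ f j → i ≡ j) where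

  sweep : ℕ → Requests N
  sweep m = zigzag m (f 0) (applyUpTo (f ∘ suc) n) (f (suc n)) (applyDownFrom (f ∘ suc) n)

  private
    up-Unique : Unique (applyUpTo f (suc n))
    up-Unique = applyUpTo⁺₁ f (suc n) λ i<j j<k eq →
      <⇒≢ i<j (f-injective (≤-trans (<⇒≤ i<j) (<⇒≤ j<k)) (<⇒≤ j<k) eq)

    down-Unique : Unique (applyDownFrom (f ∘ suc) (suc n))
    down-Unique = applyDownFrom⁺₁ (f ∘ suc) (suc n) λ j<i i<k eq →
      <⇒≢ (s<s j<i) (f-injective (≤-trans j<i (<⇒≤ i<k)) i<k (sym eq))

    up-length : suc (length (applyUpTo (f ∘ suc) n)) ≡ suc n
    up-length = cong suc (length-applyUpTo (f ∘ suc) n)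

    down-length : suc (length (applyDownFrom (f ∘ suc) n)) ≡ suc n
    down-length = cong suc (length-applyDownFrom (f ∘ suc) n)

    bottom∉down : f 0 ∉ applyDownFrom (f ∘ suc) (suc n)
    bottom∉down ∈down with i , i<k , eq ← ∈-applyDownFrom⁻ (f ∘ suc) ∈down =
      contradiction (f-injective z≤n i<k eq) λ ()

    top∉up : f (suc n) ∉ applyUpTo f (suc n)
    top∉up ∈up with i , i<k , eq ← ∈-applyUpTo⁻ f ∈up =
      <⇒≢ i<k (sym (f-injective ≤-refl (<⇒≤ i<k) eq))

    up⊆down : applyUpTo (f ∘ suc) n ⊆ applyDownFrom (f ∘ suc) n
    up⊆down ∈up with i , i<n , refl ← ∈-applyUpTo⁻ (f ∘ suc) ∈up = ∈-applyDownFrom⁺ (f ∘ suc) i<n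

    down⊆up : applyDownFrom (f ∘ suc) n ⊆ applyUpTo (f ∘ suc) n
    down⊆up ∈down with i , i<n , refl ← ∈-applyDownFrom⁻ (f ∘ suc) ∈down = ∈-applyUpTo⁺ (f ∘ suc) i<n

  length-sweep : ∀ m → length (sweep m) ≡ suc (m * suc n)
  length-sweep m = length-zigzag m up-length down-length

  FWF-sweep : ∀ m → FWF (suc n) (sweep m) ≡ suc (m * suc n)
  FWF-sweep m = FWF-zigzag m (inj₁ refl) (λ ()) up-length down-length
    up-Unique down-Unique bottom∉down top∉up

  LRU-sweep : ∀ m → LRU (suc n) (sweep (suc m)) ≤ suc n + suc m
  LRU-sweep m = LRU-zigzag-from-empty m up-length down-length up-Unique up⊆down down⊆up

  module _ (G : Graph N) (f-walk : ∀ {i} → i < suc n → Graph._~_ G (f i) (f (suc i))) where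

    open Graph G

    -- Proved together with the reversed walk, since what follows the first leg is a zigzag from the
    -- other end. Downward steps are edges by symmetry.
    sweep-∈L : ∀ m → sweep m ∈L G
    reverse-sweep-∈L : ∀ m →
      zigzag m (f (suc n)) (applyDownFrom (f ∘ suc) n) (f 0) (applyUpTo (f ∘ suc) n) ∈L G

    sweep-∈L zero    = [-]
    sweep-∈L (suc m) = Linked-applyUpTo-++ f (suc n) (inj₂ ∘ f-walk) (reverse-sweep-∈L m)

    reverse-sweep-∈L zero    = [-]
    reverse-sweep-∈L (suc m) =
      Linked-applyDownFrom-++ f (suc n) (inj₂ ∘ ~-sym ∘ f-walk) (sweep-∈L m)

-- Relative minimum and maximum.

module _ {N : ℕ} (n : ℕ) (G : Graph N) where

  private
    k = suc n

  -- Truncated subtraction is exact because LRU never faults more often than FWF; the estimates can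
  -- thus be made in `ℕ`.
  difference≡∸ : ∀ I → difference G (FWF k) (LRU k) I ≡ + (FWF k I ∸ LRU k I)
  difference≡∸ I = trans (ℤ.m-n≡m⊖n (FWF k I) (LRU k I)) (ℤ.⊖-≥ (proj₁ (LRU-FWF-bounds z<s I)))

  relativeMin : Fin N → IsRelativeMin G (FWF k) (LRU k) 0ℚ
  relativeMin p = (λ _ → ℤ.0ℤ) , isMin , isLimInf
    where
    constant-difference : ∀ m → difference G (FWF k) (LRU k) (replicate m p) ≡ ℤ.0ℤ
    constant-difference zero = refl
    constant-difference (suc m) =
      cong₂ (λ F L → + F ℤ.- + L) (faults-constant k evictFWF m p) (faults-constant k evictLRU m p)

    isMin : ∀ m → IsMin G (FWF k) (LRU k) m ℤ.0ℤ
    isMin m =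
      (replicate m p , constant-∈L G p m , length-replicate m , constant-difference m) ,
      λ I _ _ → subst (ℤ.0ℤ ℤ.≤_) (sym (difference≡∸ I)) (ℤ.+≤+ z≤n)

    isLimInf : IsLimInf (perRequest G (FWF k) (LRU k) (λ _ → ℤ.0ℤ)) 0ℚ
    isLimInf ε 0<ε =
      (0 , λ m _ → subst (0ℚ - ε ℚ.<_) (sym (ℚ.0/n≡0 (suc m)))
        (p<q+r⇒p-r<q {0ℚ} {0ℚ} {ε} (p<p+q {0ℚ} 0<ε))) ,
      λ M → M , ≤-refl , subst (ℚ._< 0ℚ ℚ.+ ε) (sym (ℚ.0/n≡0 (suc M))) (p<p+q {0ℚ} 0<ε)

  -- From `F ≤ k * L` the left-hand side is at most `F * k ∸ F`, which is `n * F`, and `F` is at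
  -- most the number of requests.
  difference-bound : ∀ (I : Requests N) → (FWF k I ∸ LRU k I) * k ≤ n * length I
  difference-bound I = begin
    (F ∸ L) * k        ≡⟨ ℕ.*-distribʳ-∸ k F L ⟩
    F * k ∸ L * k      ≤⟨ ℕ.∸-monoʳ-≤ (F * k)
                            (≤-trans (proj₂ (LRU-FWF-bounds z<s I)) (≤-reflexive (*-comm k L))) ⟩
    F * k ∸ F          ≡⟨ cong (_∸ F) (*-suc F n) ⟩
    F + F * n ∸ F      ≡⟨ ℕ.m+n∸m≡n F (F * n) ⟩
    F * n              ≡⟨ *-comm F n ⟩
    n * F              ≤⟨ *-monoʳ-≤ n (faultsFrom≤length k evictFWF [] [] I) ⟩
    n * length I       ∎
    where
    open ≤-Reasoning
    F = FWF k I
    L = LRU k I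

  -- For a sweep with `t` legs, of length `l`, FWF faults on all `l` requests and `e` is the
  -- difference. Divided by `k * l`, the claim says that `e / l` falls short of `n / k` by at most
  -- `k / l`.
  slack : ∀ L t → L ≤ k + t → n * suc (t * k) ≤ ((suc (t * k) ∸ L) + k) * k
  -- Adding `l` to both sides turns `n * l` into `k * l` and makes room for `t * k` on the right.
  slack L t L≤k+t = ℕ.+-cancelʳ-≤ l (n * l) ((e + k) * k) (begin
    n * l + l              ≡⟨ +-comm (n * l) l ⟩
    k * l                  ≤⟨ *-monoʳ-≤ k (ℕ.m≤n+m∸n l L) ⟩
    k * (L + e)            ≤⟨ *-monoʳ-≤ k (+-monoˡ-≤ e L≤k+t) ⟩
    k * ((k + t) + e)      ≡⟨ expand k t e ⟩
    (e + k) * k + t * k    ≤⟨ +-monoʳ-≤ ((e + k) * k) (n≤1+n (t * k)) ⟩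
    (e + k) * k + l        ∎)
    where
    open ≤-Reasoning
    l = suc (t * k)
    e = l ∸ L
    expand : ∀ k t e → k * ((k + t) + e) ≡ (e + k) * k + t * k
    expand = solve-∀

  -- The upper bound holds at every index; sweeps approach it along the lengths `suc (t * k)`.
  relativeMax : B.Decidable (Graph._~_ G) → (f : ℕ → Fin N) →
    (∀ {i j} → i ≤ k → j ≤ k → f i ≡ f j → i ≡ j) →
    (∀ {i} → i < k → Graph._~_ G (f i) (f (suc i))) →
    IsRelativeMax G (FWF k) (LRU k) (+ n / k)
  relativeMax _~?_ f f-injective f-walk = proj₁ ∘ max , proj₂ ∘ max , λ ε 0<ε →
    (0 , λ m _ → ℚ.≤-<-trans (upper m) (p<p+q 0<ε)) , lower ε 0<ε
    where
    max : ∀ m → ∃[ x ] IsMax G (FWF k) (LRU k) m x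
    max = max-exists G _~?_ (f 0) (FWF k) (LRU k)

    a : ℕ → ℚ
    a = perRequest G (FWF k) (LRU k) (proj₁ ∘ max)

    upper : ∀ m → a m ℚ.≤ + n / k
    upper m with (I , _ , |I| , d≡) , _ ← proj₂ (max (suc m)) = subst (ℚ._≤ + n / k)
      (cong (_/ suc m) (trans (sym (difference≡∸ I)) d≡))
      (/-mono-≤-pos (FWF k I ∸ LRU k I) m n n
        (subst (λ l → (FWF k I ∸ LRU k I) * k ≤ n * l) |I| (difference-bound I)))

    lower : ∀ ε → 0ℚ ℚ.< ε → ∀ M → ∃[ m ] (M ≤ m × + n / k - ε ℚ.< a m)
    -- By the index shift, `t * k` stands for the length `l` of a sweep with `t` legs. The choice of
    -- `t` puts this index above both `M` and `B * k`.
    lower ε 0<ε M with B , B-large ← archimedean k ε 0<ε = t * k , M≤tk , p<q+r⇒p-r<q (begin-strict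
      + n / k                                    ≤⟨ /-mono-≤-pos n n (e + k) (t * k)
                                                  (slack (LRU k I) t (LRU-sweep n f f-injective (M + B))) ⟩
      (+ e ℤ.+ + k) / l                          ≡⟨ /-distribʳ-+ (+ e) (+ k) (t * k) ⟩
      + e / l ℚ.+ + k / l                        ≤⟨ ℚ.+-monoˡ-≤ (+ k / l) e≤a ⟩
      a (t * k) ℚ.+ + k / l                      <⟨ ℚ.+-monoʳ-< (a (t * k)) (B-large (t * k) Bk≤tk) ⟩
      a (t * k) ℚ.+ ε                            ∎)
      where
      open ℚ.≤-Reasoning
      t = suc (M + B)
      l = suc (t * k)
      I = sweep n f f-injective t
      e = l ∸ LRU k I

      Bk≤tk : B * k ≤ t * k
      Bk≤tk = ℕ.*-monoˡ-≤ k (m≤n⇒m≤1+n (m≤n+m B M))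

      M≤tk : M ≤ t * k
      M≤tk = ≤-trans (m≤n⇒m≤1+n (m≤m+n M B)) (ℕ.m≤m*n t k)

      e≤a : + e / l ℚ.≤ a (t * k)
      e≤a = /-mono-≤ (+ e) (t * k) (proj₁ (max l)) (t * k) (ℤ.*-monoʳ-≤-nonNeg (+ l)
        (subst (ℤ._≤ proj₁ (max l))
          (trans (difference≡∸ I) (cong (λ F → + (F ∸ LRU k I)) (FWF-sweep n f f-injective t)))
          (proj₂ (proj₂ (max l)) I (sweep-∈L n f f-injective G f-walk t)
            (length-sweep n f f-injective t))))

-- A path in the cycle.

toℕ-mod : ∀ {i N} .{{_ : NonZero N}} → i < N → toℕ (i mod N) ≡ i
toℕ-mod {i} {N} i<N = trans (toℕ-fromℕ< (m%n<n i N)) (m<n⇒m%n≡m i<N)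

mod-injective : ∀ {i j N} .{{_ : NonZero N}} → i < N → j < N → i mod N ≡ j mod N → i ≡ j
mod-injective i<N j<N eq = trans (sym (toℕ-mod i<N)) (trans (cong toℕ eq) (toℕ-mod j<N))

mod-CycleNext : ∀ {i N} .{{_ : NonZero N}} → suc i < N → CycleNext (i mod N) (suc i mod N)
mod-CycleNext 1+i<N = inj₁ (trans (toℕ-mod 1+i<N) (cong suc (sym (toℕ-mod (<⇒≤ 1+i<N)))))

theorem8 : ∀ (k r : ℕ) .{{_ : NonZero k}} (2≤k : 2 ≤ k) (1≤r : 1 ≤ r) → r ≤ k ∸ 1 →
    IsRelativeInterval (cycle (k + r) (+-mono-≤ 2≤k 1≤r)) (FWF k) (LRU k) (0ℚ , 1ℚ - (+ 1) / k)
theorem8 k@(suc n) r 2≤k 1≤r _ =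
  relativeMin n G Fin.zero ,
  subst (IsRelativeMax G (FWF k) (LRU k)) (sym (1-1/n n))
    -- The path runs through the vertices 0 to `k`. As `1 ≤ r`, these lie below `k + r`, so
    -- reduction modulo `k + r` fixes them and the path does not wrap around.
    (relativeMax n G (λ i j → cycleNext? i j ⊎-dec cycleNext? j i) (_mod (k + r))
      (λ i≤k j≤k → mod-injective (≤k⇒<N i≤k) (≤k⇒<N j≤k))
      (λ i<k → inj₁ (mod-CycleNext (≤k⇒<N i<k))))
  where
  G : Graph (k + r)
  G = cycle (k + r) (+-mono-≤ 2≤k 1≤r)

  ≤k⇒<N : ∀ {i} → i ≤ k → i < k + r
  ≤k⇒<N i≤k = ≤-trans (≤-reflexive (+-comm 1 _)) (+-mono-≤ i≤k 1≤r)
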